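{- Let $U$ be a finite set and $\mathcal{O}\subseteq\mathcal{P}(U)$ a set of obligations (not assumed independent), and let $X\subseteq U$. Then: (1.1) If $X\prec_{l,s}U\setminus X$, then $X$ is $\preceq_s$-closed. (1.2) If $X\prec_{l,s}U\setminus X$, then $X$ contains all best elements of $U$. (2.1) If $X$ is (ui), then $X$ is $\preceq_s$-closed. (2.2) $X$ being (ui) does not necessarily imply that $X$ contains all $\preceq_s$-best elements of $U$. (3.1) If $X\in\mathcal{D}(\mathcal{O})$, then $X$ is $\preceq_s$-closed. (3.2) If $X\in\mathcal{D}(\mathcal{O})$, then $X$ contains all $\preceq_s$-best elements of $U$. (4.1) If $X$ is an improving neighbourhood of the set of $\preceq_s$-best elements of $U$, then $X$ is $\preceq_s$-closed. (4.2) If $X$ is an improving neighbourhood of the set of best elements of $U$, then $X$ contains all best elements of $U$.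
   Context: $U$ is a finite set (the set of situations under consideration), and $\mathcal{O}\subseteq\mathcal{P}(U)$ is a set of "obligations". For $x,y\in U$: - $\mathcal{O}(x):=\{O\in\mathcal{O}: x\in O\}$. - Quality (set variant; smaller means better): $x\preceq_s y$ iff $\mathcal{O}(y)\subseteq\mathcal{O}(x)$; $x\prec_s y$ iff $\mathcal{O}(y)\subsetneq\mathcal{O}(x)$. - Distance (set variant): $d_s(x,y):=\mathcal{O}(x)\,\triangle\,\mathcal{O}(y)$ (symmetric difference); distances are compared by inclusion. - $[x,z]_s:=\{y\in U: d_s(x,z)=d_s(x,y)\cup d_s(y,z)\}$. - A best ($\preceq_s$-best) element of $U$ is some $x\in U$ such that there is no $z\in U$ with $z\prec_s x$. - $X\subseteq U$ is $\preceq_s$-closed iff for all $x\in X$, $y\in U$: $y\preceq_s x$ implies $y\in X$. - An element $x'$ of a set $Y$ is closest to $x$ in $Y$ iff there is no $x''\in Y$ with $d_s(x,x'')\subsetneq d_s(x,x')$. Let $x\parallel Y$ be the set of elements of $Y$ closest to $x$. - $X\prec_{l,s}Y$ iff for all $x\in X$ and all $y\in x\parallel Y$ we have $x\prec_s y$, and for all $y\in Y$ and all $x\in y\parallel X$ we have $x\prec_s y$. - $X$ is (ui) (union of intersections) iff there is a family $(\mathcal{O}_i)_{i\in I}$ with $\mathcal{O}_i\subseteq\mathcal{O}$ and $X=\bigcup_{i\in I}\bigcap\mathcal{O}_i$, where $\bigcap\emptyset:=U$. - For $\mathcal{O}'\subseteq\mathcal{O}$, $\delta:\mathcal{O}'\to\{0,1\}$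 and $m\in U$, $m\models\delta$ iff for all $O\in\mathcal{O}'$: $m\in O\Leftrightarrow\delta(O)=1$. - $X\in\mathcal{D}(\mathcal{O})$ iff for all $\mathcal{O}'\subseteq\mathcal{O}$, all $\delta:\mathcal{O}'\to\{0,1\}$ and all $m,m'\in U$ with $m,m'\models\delta$, $m\in X$, $m'\notin X$, there is $m''\in X$ with $m''\models\delta$ and $m''\prec_s m'$. - For $B\subseteq Y\subseteq U$: $Y$ is an improving neighbourhood of $B$ in $U$ iff for all $y\in Y$ and all $x$ that are closest to $y$ in $\{x'\in B: x'\preceq_s y\}$, $[x,y]_s\subseteq Y$. (The notion requires $B\subseteq Y$.)
   Formalization: (1.2) and (3.2) are stated for nonempty X: for X = ∅ and U ≠ ∅ both premises hold vacuously, yet U has a best element, which is not in X. Membership in 𝒪 and in X is assumed decidable, which excluded middle supplies. -}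

module Defs where

open import Data.Bool.Base using (Bool; true)
open import Data.Fin.Base using (Fin)
open import Data.Fin.Subset using (Subset; _∈_)
open import Data.Nat.Base using (ℕ)
open import Data.Product.Base using (Σ-syntax; ∃; ∃-syntax; _×_; _,_)
open import Function.Bundles using (_⇔_)
open import Level using (0ℓ)
open import Relation.Binary.PropositionalEquality using (_≡_)
open import Relation.Nullary using (¬_)
open import Relation.Unary using (Pred; Decidable; _⊆_; _⊂_; _≐_; _∪_; _∖_; ∁; ⋃)

-- The finite set U is Fin n, and its powerset is Subset n.  Sets of
-- subsets of U are predicates on Subset n; wherever one is quantified
-- over it is required to be decidable, since classically every such
-- predicate is (and likewise for X ⊆ U).

module Obligations {n : ℕ} (𝒪 : Pred (Subset n) 0ℓ) where

  infix 4 _≼_ _≺_ _≺ₗ_ _⊨_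

  𝒪⟨_⟩ : Fin n → Pred (Subset n) 0ℓ
  𝒪⟨ x ⟩ O = 𝒪 O × x ∈ O

  -- Smaller is better: x ≼ y when x satisfies every obligation y does.
  _≼_ : Fin n → Fin n → Set
  x ≼ y = 𝒪⟨ y ⟩ ⊆ 𝒪⟨ x ⟩

  _≺_ : Fin n → Fin n → Set
  x ≺ y = 𝒪⟨ y ⟩ ⊂ 𝒪⟨ x ⟩

  d : Fin n → Fin n → Pred (Subset n) 0ℓ
  d x y = (𝒪⟨ x ⟩ ∖ 𝒪⟨ y ⟩) ∪ (𝒪⟨ y ⟩ ∖ 𝒪⟨ x ⟩)

  [_,_] : Fin n → Fin n → Pred (Fin n) 0ℓ
  [ x , z ] y = d x z ≐ (d x y ∪ d y z)

  Best : Pred (Fin n) 0ℓ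
  Best x = ¬ (∃[ z ] z ≺ x)

  Closed : Pred (Fin n) 0ℓ → Set
  Closed X = ∀ x y → X x → y ≼ x → X y

  -- (x ∥ Y) x′ : x′ is an element of Y closest to x.
  _∥_ : Fin n → Pred (Fin n) 0ℓ → Pred (Fin n) 0ℓ
  (x ∥ Y) x′ = Y x′ × ¬ (∃[ x″ ] (Y x″ × d x x″ ⊂ d x x′))

  _≺ₗ_ : Pred (Fin n) 0ℓ → Pred (Fin n) 0ℓ → Set
  X ≺ₗ Y = (∀ x y → X x → (x ∥ Y) y → x ≺ y)
         × (∀ x y → Y y → (y ∥ X) x → x ≺ y)

  -- The intersection of the empty collection is all of U.
  ⋂₀ : Pred (Subset n) 0ℓ → Pred (Fin n) 0ℓ
  ⋂₀ 𝒪′ x = ∀ O → 𝒪′ O → x ∈ O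

  UI : Pred (Fin n) 0ℓ → Set₁
  UI X = Σ[ I ∈ Set ] Σ[ 𝒪ᵢ ∈ (I → Pred (Subset n) 0ℓ) ]
           (∀ i → Decidable (𝒪ᵢ i))
         × (∀ i → 𝒪ᵢ i ⊆ 𝒪)
         × X ≐ ⋃ I (λ i → ⋂₀ (𝒪ᵢ i))

  -- δ is a function on the elements of 𝒪′.  If it assigned different
  -- values to two membership proofs of the same O, no m would satisfy it.
  _⊨_ : {𝒪′ : Pred (Subset n) 0ℓ} → Fin n → (∃ 𝒪′ → Bool) → Set
  _⊨_ {𝒪′} m δ = ∀ O (O∈𝒪′ : 𝒪′ O) → m ∈ O ⇔ δ (O , O∈𝒪′) ≡ true

  𝒟 : Pred (Fin n) 0ℓ → Set₁
  𝒟 X = (𝒪′ : Pred (Subset n) 0ℓ) → Decidable 𝒪′ → 𝒪′ ⊆ 𝒪 →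
        (δ : ∃ 𝒪′ → Bool) (m m′ : Fin n) →
        m ⊨ δ → m′ ⊨ δ → X m → ¬ X m′ →
        ∃[ m″ ] (X m″ × m″ ⊨ δ × m″ ≺ m′)

  -- Y is an improving neighbourhood of B.
  ImprovingNeighbourhood : Pred (Fin n) 0ℓ → Pred (Fin n) 0ℓ → Set
  ImprovingNeighbourhood Y B =
      B ⊆ Y
    × (∀ y x → Y y → (y ∥ (λ x′ → B x′ × x′ ≼ y)) x → [ x , y ] ⊆ Y)

{-# OPTIONS --safe #-}
module Submission where

-- Finiteness of U is used only through the fact that a strict order on a
-- finite set has a minimal element below any given one: this gives closest
-- elements, and best elements below a given element.  Closedness follows from
-- the following choices, where y ≼ x and x ∈ X.
--   (1.1) If y ∉ X, let y′ ∉ X be closest to x with d x y′ ⊆ d x y.  Then x ≺ y′,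
--         so d x y′ consists of obligations satisfied by x, while those in d x y
--         are violated by x; hence d x y′ = ∅, contradicting x ≺ y′.
--   (3.1) Let δ describe x on the obligations on which x and y agree.  Any m ⊨ δ
--         satisfies no obligation that y violates, so m ⊀ y.
--   (4.1) Every best b ≼ y is closest to x among the best elements below x, and
--         y ∈ [b , x].

open import Defs
open import Data.Bool.Properties using () renaming (_≟_ to _≟ᵇ_)
open import Data.Fin.Base using (Fin; zero; suc)
open import Data.Fin.Induction using (spo-wellFounded)
open import Data.Fin.Properties using (any?; _≟_)
open import Data.Fin.Subset using (Subset; ⁅_⁆) renaming (_∈_ to _∈ₛ_)
open import Data.Fin.Subset.Properties using (_∈?_; anySubset?; x∈⁅x⁆; x∈⁅y⁆⇒x≡y)
open import Data.Nat.Base using (ℕ)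
open import Data.Product.Base using (Σ-syntax; ∃; ∃-syntax; _×_; _,_; proj₁; proj₂)
open import Data.Sum.Base using (_⊎_; inj₁; inj₂)
open import Data.Unit.Base using (⊤)
open import Data.Vec.Base using (lookup)
open import Data.Vec.Properties using ([]=⇒lookup; lookup⇒[]=; ≡-dec)
open import Function.Base using (id; _∘_; case_of_)
open import Function.Bundles using (mk⇔; module Equivalence)
open import Induction.WellFounded using (Acc; acc)
open import Level using (0ℓ; Level)
open import Relation.Binary.Core using (Rel)
import Relation.Binary.Construct.Flip.EqAndOrd as Flip
import Relation.Binary.Construct.On as On
open import Relation.Binary.Definitions using () renaming (Decidable to Decidable₂)
open import Relation.Binary.PropositionalEquality using (_≡_; refl)
open import Relation.Binary.Structures using (IsStrictPartialOrder)
open import Relation.Nullary using (Dec; yes; no; ¬_; contradiction; decidable-stable)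
open import Relation.Nullary.Decidable using (map′; _×-dec_; _→-dec_; ¬?)
open import Relation.Unary using (Pred; Decidable; _⊆_; _⊂_; _∪_; ∁; ∅; U)
open import Relation.Unary.Properties using (U?; ∅?; ∁?; _∪?_; _∩?_)
open import Relation.Unary.Relation.Binary.Subset using (⊂-isStrictPartialOrder)

private
  variable
    ℓ ℓ₁ ℓ₂ : Level
    n : ℕ

minimal-below : {_≈_ : Rel (Fin n) ℓ} {_⊏_ : Rel (Fin n) ℓ₁} {P : Pred (Fin n) ℓ₂} →
                IsStrictPartialOrder _≈_ _⊏_ → Decidable₂ _⊏_ → Decidable P →
                ∀ x → P x →
                ∃[ y ] (y ≡ x ⊎ y ⊏ x) × P y × ¬ (∃[ z ] (P z × z ⊏ y))
minimal-below {_⊏_ = _⊏_} {P = P} isSPO _⊏?_ P? x = go x (spo-wellFounded isSPO x)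
  where
  go : ∀ x → Acc _⊏_ x → P x →
       ∃[ y ] (y ≡ x ⊎ y ⊏ x) × P y × ¬ (∃[ z ] (P z × z ⊏ y))
  go x (acc rs) Px with any? (λ z → P? z ×-dec (z ⊏? x))
  ... | no  none            = x , inj₁ refl , Px , none
  ... | yes (z , Pz , z⊏x) with go z (rs z⊏x) Pz
  ...   | y , inj₁ refl , Py , min = y , inj₂ z⊏x , Py , min
  ...   | y , inj₂ y⊏z  , Py , min =
    y , inj₂ (IsStrictPartialOrder.trans isSPO y⊏z z⊏x) , Py , min

module _ {P : Pred (Subset n) ℓ₁} {Q : Pred (Subset n) ℓ₂}
         (P? : Decidable P) (Q? : Decidable Q) where

  -- A failure of inclusion is witnessed by one of finitely many subsets, so a search decides it.
  subset⊆? : Dec (P ⊆ Q)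
  subset⊆? = map′
    (λ none {O} PO → decidable-stable (Q? O) λ ¬QO → none (O , PO , ¬QO))
    (λ P⊆Q (_ , PO , ¬QO) → ¬QO (P⊆Q PO))
    (¬? (anySubset? (P? ∩? ∁? Q?)))

subset⊂? : {P : Pred (Subset n) ℓ₁} {Q : Pred (Subset n) ℓ₂} →
           Decidable P → Decidable Q → Dec (P ⊂ Q)
subset⊂? P? Q? = subset⊆? P? Q? ×-dec ¬? (subset⊆? Q? P?)

module _ {𝒪 : Pred (Subset n) 0ℓ} where
  open Obligations 𝒪

  -- An improvement of `x` keeps every obligation of `x`, hence stays in each intersection that
  -- contains `x`.
  UI⇒Closed : {X : Pred (Fin n) 0ℓ} → UI X → Closed X
  UI⇒Closed (_ , _ , _ , 𝒪ᵢ⊆𝒪 , X⊆⋃ , ⋃⊆X) x y Xx y≼x with X⊆⋃ Xx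
  ... | i , x∈⋂ = ⋃⊆X (i , λ O O∈𝒪ᵢ → proj₂ (y≼x (𝒪ᵢ⊆𝒪 i O∈𝒪ᵢ , x∈⋂ O O∈𝒪ᵢ)))

module DecidableObligations {𝒪 : Pred (Subset n) 0ℓ} (𝒪? : Decidable 𝒪) where
  open Obligations 𝒪

  𝒪⟨_⟩? : ∀ x → Decidable 𝒪⟨ x ⟩
  𝒪⟨ x ⟩? O = 𝒪? O ×-dec (x ∈? O)

  d? : ∀ x y → Decidable (d x y)
  d? x y = (𝒪⟨ x ⟩? ∩? ∁? 𝒪⟨ y ⟩?) ∪? (𝒪⟨ y ⟩? ∩? ∁? 𝒪⟨ x ⟩?)

  best-below : ∀ x → ∃[ b ] (b ≼ x × Best b)
  best-below x
    with minimal-below {P = U}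
           -- Better situations satisfy more obligations, so best means maximal for inclusion.
           (Flip.isStrictPartialOrder (On.isStrictPartialOrder 𝒪⟨_⟩ ⊂-isStrictPartialOrder))
           (λ y z → subset⊂? 𝒪⟨ z ⟩? 𝒪⟨ y ⟩?) U? x _
  ... | b , inj₁ refl , _ , min = b , id , λ (z , z≺b) → min (z , _ , z≺b)
  ... | b , inj₂ b≺x , _ , min = b , proj₁ b≺x , λ (z , z≺b) → min (z , _ , z≺b)

  closest-below : {X : Pred (Fin n) 0ℓ} → Decidable X →
                  ∀ x y → X y → ∃[ y′ ] (d x y′ ⊆ d x y × (x ∥ X) y′)
  closest-below X? x y Xy
    with minimal-below (On.isStrictPartialOrder (d x) ⊂-isStrictPartialOrder)
           (λ y z → subset⊂? (d? x y) (d? x z)) X? y Xy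
  ... | y′ , inj₁ refl , Xy′ , min = y′ , id , Xy′ , min
  ... | y′ , inj₂ d⊂d , Xy′ , min = y′ , proj₁ d⊂d , Xy′ , min

  module _ {X : Pred (Fin n) 0ℓ} (X? : Decidable X) where

    ≺ₗ⇒Closed : X ≺ₗ ∁ X → Closed X
    ≺ₗ⇒Closed (X≺∁X , _) x y Xx y≼x = decidable-stable (X? y) λ ¬Xy →
      case closest-below (∁? X?) x y ¬Xy of λ (y′ , d⊆d , closest) →
        proj₂ (X≺∁X x y′ Xx closest) λ {O} x⊨O →
          decidable-stable (𝒪⟨ y′ ⟩? O) λ y′⊭O →
            -- Since `y ≼ x`, only obligations that `x` violates lie in `d x y`.
            case d⊆d (inj₁ (x⊨O , y′⊭O)) of λ where
              (inj₁ (_ , y⊭O)) → y⊭O (y≼x x⊨O)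
              (inj₂ (_ , x⊭O)) → x⊭O x⊨O

    -- A best element outside `X` would be beaten by an element of `X` closest to it. The empty `X`
    -- satisfies `X ≺ₗ ∁ X` vacuously, hence the hypothesis `∃ X`.
    ≺ₗ⇒Best⊆ : ∃ X → X ≺ₗ ∁ X → Best ⊆ X
    ≺ₗ⇒Best⊆ (x , Xx) (_ , X≺∁X) {b} best = decidable-stable (X? b) λ ¬Xb →
      case closest-below X? b x Xx of λ (x′ , _ , closest) →
        best (x′ , X≺∁X x′ b ¬Xb closest)

    𝒟⇒Closed : 𝒟 X → Closed X
    𝒟⇒Closed 𝒟X x y Xx y≼x = decidable-stable (X? y) λ ¬Xy →
      case 𝒟X 𝒪′ 𝒪′? proj₁ δ x y x⊨δ y⊨δ Xx ¬Xy of λ (m , _ , m⊨δ , _ , m⊈y) →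
        m⊈y λ {O} (𝒪O , m∈O) → decidable-stable (𝒪⟨ y ⟩? O) λ y⊭O →
          -- With `y` outside `O` the implication in `𝒪′` is vacuous, so `δ` fixes `O` and carries
          -- `m∈O` over to `y`.
          let y∉O = λ y∈O → y⊭O (𝒪O , y∈O)
              O∈𝒪′ = 𝒪O , λ y∈O → contradiction y∈O y∉O
          in y∉O (Equivalence.from (y⊨δ O O∈𝒪′) (Equivalence.to (m⊨δ O O∈𝒪′) m∈O))
      where
      -- As `y ≼ x` gives the converse implication, membership in `𝒪′` says that `x` and `y` agree
      -- on `O`.
      𝒪′ : Pred (Subset n) 0ℓ
      𝒪′ O = 𝒪 O × (y ∈ₛ O → x ∈ₛ O)

      𝒪′? : Decidable 𝒪′
      𝒪′? O = 𝒪? O ×-dec (y ∈? O →-dec x ∈? O)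

      δ : ∃ 𝒪′ → _
      δ (O , _) = lookup O x

      x⊨δ : _⊨_ {𝒪′} x δ
      x⊨δ O _ = mk⇔ []=⇒lookup (lookup⇒[]= x O)

      y⊨δ : _⊨_ {𝒪′} y δ
      y⊨δ O (𝒪O , y⇒x) =
        mk⇔ ([]=⇒lookup ∘ y⇒x) (λ eq → proj₂ (y≼x (𝒪O , lookup⇒[]= x O eq)))

    𝒟⇒Best⊆ : ∃ X → 𝒟 X → Best ⊆ X
    𝒟⇒Best⊆ (x , Xx) 𝒟X {b} best = decidable-stable (X? b) λ ¬Xb →
      -- Over the empty `𝒪′` every situation satisfies `δ`, so any `x` in `X` can be set against
      -- `b`.
      case 𝒟X ∅ ∅? (λ ()) (λ ()) x b (λ _ ()) (λ _ ()) Xx ¬Xb of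
        λ (m , _ , _ , m≺b) → best (m , m≺b)

  ImprovingNeighbourhood⇒Closed : {X : Pred (Fin n) 0ℓ} →
                                  ImprovingNeighbourhood X Best → Closed X
  ImprovingNeighbourhood⇒Closed (_ , nbhd) x y Xx y≼x with best-below y
  ... | b , b≼y , best = nbhd x b Xx ((best , b≼y ∘ y≼x) , b-closest) (to , from)
    where
    -- As `b ≼ x`, `d x b` is what `b` gains over `x`. A strictly smaller `d x c` would make `b`
    -- strictly better than the best element `c`.
    b-closest : ¬ (∃[ c ] ((Best c × c ≼ x) × d x c ⊂ d x b))
    b-closest (c , (c-best , c≼x) , d⊆d , d⊉d) = c-best (b , c⊆b , b⊈c)
      where
      c⊆b : b ≼ c
      c⊆b {O} c⊨O with 𝒪⟨ x ⟩? O
      ... | yes x⊨O = b≼y (y≼x x⊨O)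
      ... | no  x⊭O with d⊆d (inj₂ (c⊨O , x⊭O))
      ...   | inj₁ (x⊨O , _) = contradiction x⊨O x⊭O
      ...   | inj₂ (b⊨O , _) = b⊨O

      b⊈c : ¬ (c ≼ b)
      b⊈c c≼b = d⊉d λ where
        (inj₁ (x⊨O , b⊭O)) → contradiction (b≼y (y≼x x⊨O)) b⊭O
        (inj₂ (b⊨O , x⊭O)) → inj₂ (c≼b b⊨O , x⊭O)

    -- Along `b ≼ y ≼ x` all three distances are gains, and those of `b` over `x` split at `y`.
    to : d b x ⊆ d b y ∪ d y x
    to (inj₂ (x⊨O , b⊭O)) = contradiction (b≼y (y≼x x⊨O)) b⊭O
    to {O} (inj₁ (b⊨O , x⊭O)) with 𝒪⟨ y ⟩? O
    ... | yes y⊨O = inj₂ (inj₁ (y⊨O , x⊭O))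
    ... | no  y⊭O = inj₁ (inj₁ (b⊨O , y⊭O))

    from : d b y ∪ d y x ⊆ d b x
    from (inj₁ (inj₁ (b⊨O , y⊭O))) = inj₁ (b⊨O , y⊭O ∘ y≼x)
    from (inj₁ (inj₂ (y⊨O , b⊭O))) = contradiction (b≼y y⊨O) b⊭O
    from (inj₂ (inj₁ (y⊨O , x⊭O))) = inj₁ (b≼y y⊨O , x⊭O)
    from (inj₂ (inj₂ (x⊨O , y⊭O))) = contradiction (y≼x x⊨O) y⊭O

-- When every subset is an obligation, the singleton ⁅ x ⁆ separates x from all
-- other elements, so everything is best.
U⇒Best : ∀ x → Obligations.Best {n} U x
U⇒Best x (z , x⊆z , z⊈x) with x∈⁅y⁆⇒x≡y x (proj₂ (x⊆z (_ , x∈⁅x⁆ x)))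
... | refl = z⊈x id

⁅⁆-UI : ∀ (x : Fin n) → Obligations.UI U (_≡ x)
⁅⁆-UI x = ⊤ , (λ _ → _≡ ⁅ x ⁆) , (λ _ O → ≡-dec _≟ᵇ_ O ⁅ x ⁆) , _ ,
  (λ { refl → _ , λ { _ refl → x∈⁅x⁆ x } }) ,
  λ (_ , y∈⋂) → x∈⁅y⁆⇒x≡y x (y∈⋂ _ refl)

fact4p2 : ( (n : ℕ) (𝒪 : Pred (Subset n) 0ℓ) → Decidable 𝒪 →
    (X : Pred (Fin n) 0ℓ) → Decidable X →
    let open Obligations 𝒪 in
    (X ≺ₗ ∁ X → Closed X)
    × (∃ X → X ≺ₗ ∁ X → Best ⊆ X)
    × (UI X → Closed X)
    × (𝒟 X → Closed X)
    × (∃ X → 𝒟 X → Best ⊆ X)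
    × (ImprovingNeighbourhood X Best → Closed X)
    × (ImprovingNeighbourhood X Best → Best ⊆ X) )
    × ( Σ[ n ∈ ℕ ] Σ[ 𝒪 ∈ Pred (Subset n) 0ℓ ] Σ[ X ∈ Pred (Fin n) 0ℓ ]
    let open Obligations 𝒪 in
    Decidable 𝒪 × Decidable X × ∃ X × UI X × ¬ (Best ⊆ X) )
fact4p2 =
  (λ n 𝒪 𝒪? X X? →
    let open DecidableObligations 𝒪? in
      ≺ₗ⇒Closed X? , ≺ₗ⇒Best⊆ X? , UI⇒Closed , 𝒟⇒Closed X? , 𝒟⇒Best⊆ X? ,
      ImprovingNeighbourhood⇒Closed , proj₁) ,
  -- Two situations are the fewest for which a nonempty `X` can miss one; the missed `suc zero` is
  -- still best.
  2 , U , (_≡ zero) , U? , (_≟ zero) , (zero , refl) , ⁅⁆-UI zero ,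
  λ Best⊆X → case Best⊆X (U⇒Best (suc zero)) of λ ()
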